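{- Let $G=(V,E)$ be a finite, simple, connected undirected graph with an MCS ordering $\alpha$. Run the following Recursive Decomposition Algorithm (RDA): set $\mathcal U=\emptyset$ and $W=V$; repeat: let $v$ be the vertex of $W$ with smallest $\alpha(v)$; let $H$ be the convex hull of $N_{G_W}[v]$ in $G_W$; replace $W$ by $N_{G_W}[W\setminus H]$ (computed in $G_W$; this is $\emptyset$ if $H=W$); if $H\not\subseteq U$ for every $U\in\mathcal U$, add $H$ to $\mathcal U$; until $W=\emptyset$. Then the output $\mathcal U$ is precisely the set of (vertex sets of) all atoms of $G$.
   Context: $N_G(x)$ is the neighbourhood of $x$, $N_G[x]=N_G(x)\cup\{x\}$; for $A\subseteq V$, $N_G(A)=\bigcup_{w\in A}N_G(w)\setminus A$, $N_G[A]=N_G(A)\cup A$; $G_A$ is the induced subgraph on $A$. MCS ordering: Maximum Cardinality Search numbers the vertices $n,n-1,\dots,1$ ($n=|V|$); all weights start at $0$; at each step an unnumbered vertex of maximum current weight is chosen (ties arbitrary) and receives the next number, then each of its unnumbered neighbours has its weight increased by $1$; the resulting bijection $\alpha:V\to\{1,\dots,n\}$ is an MCS ordering. A subgraph $G_A$ is convex in a graph $G$ if for every pair of non-adjacent $x,y\in A$ there is no $x$–$y$ path in $G$ with all internal vertices outside $A$; the convex hull of $R$ is the unique inclusion-minimal $H\supseteq R$ with $G_H$ convex. A clique minimal separator of a graph is a set $S$ of pairwise adjacent vertices which, for some vertices $x,y$, meets every $x$–$y$ path while no proper subset of $S$ does. An atom of $G$ is an inclusion-maximal vertex set $A$ such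 that $G_A$ is connected and has no clique minimal separator (as a graph in its own right). -}

module Defs where

open import Data.Nat using (ℕ; zero; suc)
open import Data.Bool using (Bool; true; false; T; _∧_; _∨_)
open import Data.Fin using (Fin; _<_; _≤_; _<?_)
open import Data.Fin.Subset using (Subset; _∈_; _∉_; _⊆_; _⊂_; _─_; ⁅_⁆; ∣_∣; _∩_; Nonempty; Empty)
open import Data.Fin.Subset.Properties using (_∈?_)
open import Data.Fin.Properties using (any?)
open import Data.Vec using (tabulate)
open import Data.List using (List; []; _∷_; _++_; [_])
open import Data.List.Relation.Unary.All using (All)
open import Data.List.Relation.Unary.Any using (Any)
open import Data.List.Relation.Unary.Unique.Propositional using (Unique)
import Data.List.Membership.Propositional as L
open import Data.Product using (Σ; ∃; ∃-syntax; _×_; _,_)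
open import Relation.Nullary using (¬_)
open import Relation.Nullary.Decidable using (isYes; T?; _×-dec_)
open import Relation.Binary.PropositionalEquality using (_≡_; _≢_)
open import Function.Definitions using (Bijective)

record Graph (n : ℕ) : Set where
  field
    adj    : Fin n → Fin n → Bool
    sym    : ∀ x y → adj x y ≡ adj y x
    irrefl : ∀ x → adj x x ≡ false

open Graph public

module _ {n : ℕ} (G : Graph n) where

  Adj : Fin n → Fin n → Set
  Adj x y = T (adj G x y)

  V : Subset n
  V = Data.Fin.Subset.⊤

  closedNbhd : (W A : Subset n) → Subset n
  closedNbhd W A = tabulate λ y →
    isYes (y ∈? W) ∧
    (isYes (y ∈? A) ∨ isYes (any? (λ w → (w ∈? A) ×-dec ((w ∈? W) ×-dec T? (adj G w y)))))

  -- Walk x = v₀, v₁, …, v_k = y (k ≥ 1) in G_W; the index list is the list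
  -- of internal vertices v₁ … v_{k-1}.
  data Walk (W : Subset n) : Fin n → Fin n → List (Fin n) → Set where
    edge : ∀ {x y} → x ∈ W → y ∈ W → Adj x y → Walk W x y []
    step : ∀ {x z y vs} → x ∈ W → Adj x z → Walk W z y vs → Walk W x y (z ∷ vs)

  Path : (W : Subset n) → Fin n → Fin n → List (Fin n) → Set
  Path W x y vs = Walk W x y vs × Unique (x ∷ vs ++ [ y ])

  Connected : Subset n → Set
  Connected W = Nonempty W ×
    (∀ x y → x ∈ W → y ∈ W → x ≢ y → ∃[ vs ] Path W x y vs)

  IsConvex : (W A : Subset n) → Set
  IsConvex W A = A ⊆ W ×
    (∀ x y → x ∈ A → y ∈ A → ¬ Adj x y →
       ∀ vs → ¬ (Path W x y vs × All (_∉ A) vs))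

  IsConvexHull : (W R H : Subset n) → Set
  IsConvexHull W R H = R ⊆ H × IsConvex W H ×
    (∀ H' → R ⊆ H' → IsConvex W H' → H' ⊆ H → H ⊆ H')

  IsClique : (W S : Subset n) → Set
  IsClique W S = S ⊆ W × (∀ x y → x ∈ S → y ∈ S → x ≢ y → Adj x y)

  Separates : (W S : Subset n) → Fin n → Fin n → Set
  Separates W S x y = x ∈ W × y ∈ W × x ∉ S × y ∉ S × x ≢ y ×
    (∀ vs → Path W x y vs → Any (_∈ S) vs)

  IsMinimalSeparator : (W S : Subset n) → Set
  IsMinimalSeparator W S = S ⊆ W × ∃[ x ] ∃[ y ]
    (Separates W S x y × (∀ S' → S' ⊂ S → ¬ Separates W S' x y))

  IsCliqueMinimalSeparator : (W S : Subset n) → Set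
  IsCliqueMinimalSeparator W S = IsClique W S × IsMinimalSeparator W S

  AtomCandidate : Subset n → Set
  AtomCandidate A = Connected A × (∀ S → ¬ IsCliqueMinimalSeparator A S)

  IsAtom : Subset n → Set
  IsAtom A = AtomCandidate A × (∀ B → A ⊆ B → AtomCandidate B → B ⊆ A)

  -- MCS ordering.  α v : Fin n stands for the number α(v) - 1 ∈ {0,…,n-1}.
  -- When v is numbered, the already numbered vertices are exactly those u
  -- with α u > α v, and the current weight of a vertex u is the number of
  -- its neighbours among them.  α is an MCS ordering iff it is a bijection
  -- and at each step the chosen vertex has maximum weight among the
  -- unnumbered vertices.
  numberedBefore : (Fin n → Fin n) → Fin n → Subset n
  numberedBefore α v = tabulate λ u → isYes (α v <? α u)

  nbhd : Fin n → Subset n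
  nbhd x = tabulate λ y → adj G x y

  weight : (Fin n → Fin n) → Fin n → Fin n → ℕ
  weight α v u = ∣ nbhd u ∩ numberedBefore α v ∣

  IsMCSOrdering : (Fin n → Fin n) → Set
  IsMCSOrdering α = Bijective _≡_ _≡_ α ×
    (∀ v u → α u < α v → weight α v u Data.Nat.≤ weight α v v)

  -- Runs of the Recursive Decomposition Algorithm: RDA α W 𝒰 𝒰f means
  -- that, starting the loop in state (W, 𝒰), the algorithm terminates
  -- with output 𝒰f.  (Started with W = V ≠ ∅, the loop body is executed
  -- at least once, as in a repeat–until loop.)
  data RDA (α : Fin n → Fin n) : Subset n → List (Subset n) → List (Subset n) → Set where
    done : ∀ {W 𝒰} → Empty W → RDA α W 𝒰 𝒰
    add  : ∀ {W 𝒰 𝒰f} v H →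
           v ∈ W → (∀ u → u ∈ W → α v ≤ α u) →
           IsConvexHull W (closedNbhd W ⁅ v ⁆) H →
           (∀ U → U L.∈ 𝒰 → ¬ (H ⊆ U)) →
           RDA α (closedNbhd W (W ─ H)) (𝒰 ++ [ H ]) 𝒰f →
           RDA α W 𝒰 𝒰f
    skip : ∀ {W 𝒰 𝒰f} v H →
           v ∈ W → (∀ u → u ∈ W → α v ≤ α u) →
           IsConvexHull W (closedNbhd W ⁅ v ⁆) H →
           (∃[ U ] (U L.∈ 𝒰 × H ⊆ U)) →
           RDA α (closedNbhd W (W ─ H)) 𝒰 𝒰f →
           RDA α W 𝒰 𝒰f

{-# OPTIONS --safe #-}
module Submission where

-- Call R unseparated in M if no clique K of M separates two vertices of R ─ K.
-- A nonempty set is an atom candidate iff it is unseparated in itself, and every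
-- nonempty unseparated set lies in an atom.
--
-- Counting argument for MCS: let S separate D from E among the numbered vertices.
-- If the last numbered vertex outside S is in E, then every unnumbered vertex has
-- at most |S| neighbours in D ∪ S, and symmetrically.  Hence a clique K containing
-- the last vertex v of X = {u : α u ≥ α v} cannot have neighbours of v in two
-- components of X ─ K, so N_X[v] lies in an atom B of G.
--
-- Neither connectedness nor the MCS property passes to the successive sets W, but
-- the invariant "every atom is in 𝒰 or inside W" does.  As W ⊆ X and atoms are
-- convex, the hull H of N_W[v] lies in B.  An atom inside W that is not inside H
-- survives in the next W, because all its vertices in H have neighbours outside H;
-- v does not survive, so if B is not yet in 𝒰 then B = H.

open import Defs
open import Data.Nat using (ℕ; suc; zero; s≤s)
import Data.Nat as ℕ
import Data.Nat.Properties as ℕ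
open import Data.Bool using (Bool; T)
open import Data.Bool.Properties using (T-≡; T-∧; T-∨)
open import Data.Fin using (Fin; toℕ; fromℕ<)
open import Data.Fin.Properties using (_≟_; any?; all?; toℕ-fromℕ<; toℕ-injective; toℕ<n)
open import Data.Fin.Subset using (Subset; inside; outside; _⊆_; _⊂_; _∩_; _∪_; _─_; _-_; ∁; ⁅_⁆; ∣_∣; Nonempty)
open import Data.Fin.Subset using () renaming (_∈_ to _∈ₛ_; _∉_ to _∉ₛ_; ⊥ to ∅)
open import Data.Fin.Subset.Properties
open import Data.Fin.Subset.Induction using (Acc; acc; ⊂-wellFounded; ⊃-wellFounded)
open import Data.Vec using (tabulate; _∷_; []; here; there)
open import Data.Vec.Properties using (lookup∘tabulate; []=⇒lookup; lookup⇒[]=)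
open import Data.List using (List; []; _∷_; _++_; [_])
open import Data.List.Membership.Propositional using (_∈_; find; lose)
open import Data.List.Membership.Propositional.Properties using (∈-++⁺ˡ; ∈-++⁺ʳ; ∈-++⁻)
open import Data.List.Relation.Unary.All using (All; []; _∷_)
import Data.List.Relation.Unary.All as All
import Data.List.Relation.Unary.All.Properties as All
open import Data.List.Relation.Unary.Any using (Any; here; there)
import Data.List.Relation.Unary.Any as Any
open import Data.List.Relation.Unary.AllPairs using ([]; _∷_)
open import Data.List.Relation.Unary.Unique.Propositional using (Unique)
open import Data.Product using (∃; ∃-syntax; _×_; _,_; proj₁; proj₂)
open import Data.Sum using (_⊎_; inj₁; inj₂; [_,_]′)
import Data.Sum as Sum
open import Data.Empty using (⊥; ⊥-elim)
open import Function.Base using (_∘_; id)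
open import Function.Bundles using (_⇔_; mk⇔; module Equivalence)
open import Relation.Nullary using (¬_; Dec; yes; no; contradiction)
open import Relation.Nullary.Decidable using (T?; ¬?; isYes; _×-dec_; _⊎-dec_; _→-dec_; map′; decidable-stable; toWitness; fromWitness)
open import Relation.Binary.PropositionalEquality using (_≡_; _≢_; refl; subst; cong; ≢-sym) renaming (sym to ≡-sym; trans to ≡-trans)

private
  variable
    n : ℕ

-- Subsets of a finite set

∈-tabulate⁺ : {f : Fin n → Bool} {x : Fin n} → T (f x) → x ∈ₛ tabulate f
∈-tabulate⁺ {f = f} {x} t =
  lookup⇒[]= x (tabulate f) (≡-trans (lookup∘tabulate f x) (Equivalence.to T-≡ t))

∈-tabulate⁻ : {f : Fin n → Bool} {x : Fin n} → x ∈ₛ tabulate f → T (f x)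
∈-tabulate⁻ {f = f} {x} m =
  Equivalence.from T-≡ (≡-trans (≡-sym (lookup∘tabulate f x)) ([]=⇒lookup m))

module _ {P : Fin n → Set} (P? : ∀ x → Dec (P x)) where

  comprehension : Subset n
  comprehension = tabulate λ x → isYes (P? x)

  ∈-comprehension⁺ : ∀ {x} → P x → x ∈ₛ comprehension
  ∈-comprehension⁺ p = ∈-tabulate⁺ (fromWitness p)

  ∈-comprehension⁻ : ∀ {x} → x ∈ₛ comprehension → P x
  ∈-comprehension⁻ m = toWitness (∈-tabulate⁻ m)

x∈p─q⇒x∉q : ∀ (p q : Subset n) {x} → x ∈ₛ p ─ q → x ∉ₛ q
x∈p─q⇒x∉q (_ ∷ p) (_ ∷ q) (there m) (there m′) = x∈p─q⇒x∉q p q m m′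

x∉p-x : ∀ (p : Subset n) x → x ∉ₛ p - x
x∉p-x p x m = x∈p─q⇒x∉q p ⁅ x ⁆ m (x∈⁅x⁆ x)

─-monoˡ-⊆ : ∀ {p q : Subset n} r → p ⊆ q → p ─ r ⊆ q ─ r
─-monoˡ-⊆ {p = p} r p⊆q m = x∈p∧x∉q⇒x∈p─q (p⊆q (p─q⊆p p r m)) (x∈p─q⇒x∉q p r m)

p⊈q⇒∃ : ∀ {p q : Subset n} → ¬ p ⊆ q → ∃[ x ] (x ∈ₛ p × x ∉ₛ q)
p⊈q⇒∃ {p = p} {q} p⊈q with any? (λ x → x ∈? p ×-dec ¬? (x ∈? q))
... | yes w = w
... | no ∄ = contradiction
  (λ {x} x∈p → decidable-stable (x ∈? q) (λ x∉q → ∄ (x , x∈p , x∉q))) p⊈q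

∣p∣≤1+∣p-x∣ : ∀ (p : Subset n) x → ∣ p ∣ ℕ.≤ suc ∣ p - x ∣
∣p∣≤1+∣p-x∣ (s ∷ p) Fin.zero with s
... | inside  = s≤s (subst (λ q → ∣ p ∣ ℕ.≤ ∣ q ∣) (≡-sym (p─⊥≡p p)) ℕ.≤-refl)
... | outside = subst (λ q → ∣ p ∣ ℕ.≤ suc ∣ q ∣) (≡-sym (p─⊥≡p p)) (ℕ.n≤1+n _)
∣p∣≤1+∣p-x∣ (inside  ∷ p) (Fin.suc x) = s≤s (∣p∣≤1+∣p-x∣ p x)
∣p∣≤1+∣p-x∣ (outside ∷ p) (Fin.suc x) = ∣p∣≤1+∣p-x∣ p x

module _ {P : Subset n → Set} (P? : ∀ S → Dec (P S)) where

  allSubset? : Dec (∀ S → P S)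
  allSubset? with anySubset? (λ S → ¬? (P? S))
  ... | yes (S , ¬p) = no λ p → ¬p (p S)
  ... | no ∄ = yes λ S → decidable-stable (P? S) (λ ¬p → ∄ (S , ¬p))

  -- Well-founded descent along strict inclusion. `P` may fail to be monotone, so each round
  -- searches all proper subsets.
  minimalSubset : ∀ A → P A → ∃[ M ] (M ⊆ A × P M × (∀ S → S ⊆ M → P S → M ⊆ S))
  minimalSubset A = descend A (⊂-wellFounded A)
    where
    descend : ∀ A → Acc _⊂_ A → P A → ∃[ M ] (M ⊆ A × P M × (∀ S → S ⊆ M → P S → M ⊆ S))
    descend A (acc rs) pA with anySubset? (λ S → S ⊂? A ×-dec P? S)
    ... | yes (S , S⊂A , pS) with descend S (rs S⊂A) pS
    ...   | M , M⊆S , pM , min = M , (λ m → proj₁ S⊂A (M⊆S m)) , pM , min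
    descend A (acc rs) pA | no ∄ = A , (λ m → m) , pA , λ S S⊆A pS {x} x∈A →
      decidable-stable (x ∈? S) (λ x∉S → ∄ (S , (S⊆A , x , x∈A , x∉S) , pS))

  maximalSubset : ∀ A → P A → ∃[ M ] (A ⊆ M × P M × (∀ S → M ⊆ S → P S → S ⊆ M))
  maximalSubset A = ascend A (⊃-wellFounded A)
    where
    ascend : ∀ A → Acc (λ p q → q ⊂ p) A → P A → ∃[ M ] (A ⊆ M × P M × (∀ S → M ⊆ S → P S → S ⊆ M))
    ascend A (acc rs) pA with anySubset? (λ S → A ⊂? S ×-dec P? S)
    ... | yes (S , A⊂S , pS) with ascend S (rs A⊂S) pS
    ...   | M , S⊆M , pM , max = M , (λ m → S⊆M (proj₁ A⊂S m)) , pM , max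
    ascend A (acc rs) pA | no ∄ = A , (λ m → m) , pA , λ S A⊆S pS {x} x∈S →
      decidable-stable (x ∈? A) (λ x∉A → ∄ (S , (A⊆S , x , x∈S , x∉A) , pS))

module _ (G : Graph n) where

  infix 4 _~_
  _~_ : Fin n → Fin n → Set
  _~_ = Adj G

  ~-sym : ∀ {x y} → x ~ y → y ~ x
  ~-sym {x} {y} = subst T (sym G x y)

  ~-dec : ∀ x y → Dec (x ~ y)
  ~-dec x y = T? (adj G x y)

  -- Reachability in induced subgraphs

  -- Unlike `Path`, it allows length zero and repetitions, so it composes and reverses freely;
  -- `reach⇒path` recovers paths.
  data Reach (Z : Subset n) : Fin n → Fin n → Set where
    stop : ∀ {x} → x ∈ₛ Z → Reach Z x x
    go   : ∀ {x z y} → x ∈ₛ Z → x ~ z → Reach Z z y → Reach Z x y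

  module _ {Z : Subset n} where

    source∈ : ∀ {x y} → Reach Z x y → x ∈ₛ Z
    source∈ (stop m)   = m
    source∈ (go m _ _) = m

    target∈ : ∀ {x y} → Reach Z x y → y ∈ₛ Z
    target∈ (stop m)   = m
    target∈ (go _ _ r) = target∈ r

    reach-mono : ∀ {Z′} → Z ⊆ Z′ → ∀ {x y} → Reach Z x y → Reach Z′ x y
    reach-mono i (stop m)   = stop (i m)
    reach-mono i (go m e r) = go (i m) e (reach-mono i r)

    reach-trans : ∀ {x y z} → Reach Z x y → Reach Z y z → Reach Z x z
    reach-trans (stop _)   s = s
    reach-trans (go m e r) s = go m e (reach-trans r s)

    reach-snoc : ∀ {x y z} → Reach Z x y → y ~ z → z ∈ₛ Z → Reach Z x z
    reach-snoc r e m = reach-trans r (go (target∈ r) e (stop m))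

    reach-sym : ∀ {x y} → Reach Z x y → Reach Z y x
    reach-sym (stop m)   = stop m
    reach-sym (go m e r) = reach-snoc (reach-sym r) (~-sym e) m

    -- Keeps what follows the last visit to `q`; without a visit the whole walk survives.
    leave : ∀ q {x y} → y ≢ q → Reach Z x y →
            Reach (Z - q) x y ⊎ ∃[ p ] (q ~ p × Reach (Z - q) p y)
    leave q y≢q (stop m) = inj₁ (stop (x∈p∧x≢y⇒x∈p-y m y≢q))
    leave q y≢q (go {x} m e r) with leave q y≢q r
    ... | inj₂ w = inj₂ w
    ... | inj₁ s with x ≟ q
    ...   | yes refl = inj₂ (_ , e , s)
    ...   | no x≢q   = inj₁ (go (x∈p∧x≢y⇒x∈p-y m x≢q) e s)

    avoid-or-hit : ∀ K {x y} → Reach Z x y → Reach (Z ─ K) x y ⊎ ∃[ k ] (k ∈ₛ K × Reach Z x k)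
    avoid-or-hit K {x} r with x ∈? K
    ... | yes x∈K = inj₂ (x , x∈K , stop (source∈ r))
    avoid-or-hit K (stop m) | no x∉K = inj₁ (stop (x∈p∧x∉q⇒x∈p─q m x∉K))
    avoid-or-hit K (go m e r) | no x∉K with avoid-or-hit K r
    ... | inj₁ s = inj₁ (go (x∈p∧x∉q⇒x∈p─q m x∉K) e s)
    ... | inj₂ (k , k∈K , s) = inj₂ (k , k∈K , go m e s)

  -- By `leave`, a walk from `x` to another vertex can be taken never to return to `x`, so the
  -- search may delete `x` before it continues.
  reach? : ∀ Z x y → Dec (Reach Z x y)
  reach? Z = search Z (⊂-wellFounded Z)
    where
    search : ∀ Z → Acc _⊂_ Z → ∀ x y → Dec (Reach Z x y)
    search Z (acc rs) x y with x ∈? Z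
    ... | no x∉Z = no λ r → x∉Z (source∈ r)
    ... | yes x∈Z with x ≟ y
    ...   | yes refl = yes (stop x∈Z)
    ...   | no x≢y with any? (λ z → ~-dec x z ×-dec search (Z - x) (rs (x∈p⇒p-x⊂p x∈Z)) z y)
    ...     | yes (z , e , r) = yes (go x∈Z e (reach-mono (p─q⊆p Z ⁅ x ⁆) r))
    ...     | no ∄ = no λ r → [ (λ s → x∉p-x Z x (source∈ s)) , ∄ ]′ (leave x (≢-sym x≢y) r)

  -- Paths

  walk-mono : ∀ {Z W} → Z ⊆ W → ∀ {x y vs} → Walk G Z x y vs → Walk G W x y vs
  walk-mono i (edge m m′ e) = edge (i m) (i m′) e
  walk-mono i (step m e w)  = step (i m) e (walk-mono i w)

  walk-source∈ : ∀ {W x y vs} → Walk G W x y vs → x ∈ₛ W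
  walk-source∈ (edge m _ _) = m
  walk-source∈ (step m _ _) = m

  walk-target∈ : ∀ {W x y vs} → Walk G W x y vs → y ∈ₛ W
  walk-target∈ (edge _ m _) = m
  walk-target∈ (step _ _ w) = walk-target∈ w

  walk-internal∈ : ∀ {W x y vs} → Walk G W x y vs → All (_∈ₛ W) vs
  walk-internal∈ (edge _ _ _) = []
  walk-internal∈ (step _ _ w) = walk-source∈ w ∷ walk-internal∈ w

  walk⇒reach : ∀ {W Z x y vs} → Walk G W x y vs → x ∈ₛ Z → All (_∈ₛ Z) vs → y ∈ₛ Z → Reach Z x y
  walk⇒reach (edge _ _ e) x∈ []       y∈ = go x∈ e (stop y∈)
  walk⇒reach (step _ e w) x∈ (p ∷ ps) y∈ = go x∈ e (walk⇒reach w p ps y∈)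

  path-suffix : ∀ {Z x z y vs} → Path G Z z y vs → x ∈ z ∷ vs → ∃[ us ] Path G Z x y us
  path-suffix p (here refl) = _ , p
  path-suffix (step _ _ w , _ ∷ u) (there i) = path-suffix (w , u) i

  -- Loop erasure: when `x` already occurs on the path found from `z`, the part of that path
  -- starting at `x` is used instead.
  reach⇒path : ∀ {Z x y} → Reach Z x y → x ≢ y → ∃[ vs ] Path G Z x y vs
  reach⇒path (stop _) x≢x = contradiction refl x≢x
  reach⇒path (go {x} {z} {y} m e r) x≢y with z ≟ y
  ... | yes refl = [] , edge m (source∈ r) e , (x≢y ∷ []) ∷ [] ∷ []
  ... | no z≢y with reach⇒path r z≢y
  ...   | vs , w , u with Any.any? (x ≟_) (z ∷ vs)
  ...     | yes i = path-suffix (w , u) i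
  ...     | no ∉  = z ∷ vs , step m e w , All.++⁺ (All.¬Any⇒All¬ _ ∉) (x≢y ∷ []) ∷ u

  unique-snoc⇒≢ : ∀ vs {y : Fin n} → Unique (vs ++ [ y ]) → All (_≢ y) vs
  unique-snoc⇒≢ []       _       = []
  unique-snoc⇒≢ (v ∷ vs) (a ∷ u) = All.head (All.++⁻ʳ vs a) ∷ unique-snoc⇒≢ vs u

  path⇒≢ : ∀ {W x y vs} → Path G W x y vs → x ≢ y
  path⇒≢ {vs = vs} (_ , a ∷ _) = All.head (All.++⁻ʳ vs a)

  separates⇒¬reach : ∀ {W S x y} → Separates G W S x y → ¬ Reach (W ─ S) x y
  separates⇒¬reach {W} {S} (_ , _ , _ , _ , x≢y , cut) r with reach⇒path r x≢y
  ... | vs , w , u = All.All¬⇒¬Any (All.map (x∈p─q⇒x∉q W S) (walk-internal∈ w))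
    (cut vs (walk-mono (p─q⊆p W S) w , u))

  ¬reach⇒separates : ∀ {W S x y} → x ∈ₛ W ─ S → y ∈ₛ W ─ S → ¬ Reach (W ─ S) x y → Separates G W S x y
  ¬reach⇒separates {W} {S} {x} {y} x∈ y∈ ¬r =
    p─q⊆p W S x∈ , p─q⊆p W S y∈ , x∈p─q⇒x∉q W S x∈ , x∈p─q⇒x∉q W S y∈ ,
    (λ { refl → ¬r (stop x∈) }) , cut
    where
    cut : ∀ vs → Path G W x y vs → Any (_∈ₛ S) vs
    cut vs (w , _) = decidable-stable (Any.any? (_∈? S) vs) λ ∄ →
      ¬r (walk⇒reach w x∈
           (All.zipWith (λ (m , ∉) → x∈p∧x∉q⇒x∈p─q m ∉) (walk-internal∈ w , All.¬Any⇒All¬ vs ∄)) y∈)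

  -- Convexity

  -- The ends of an excursion outside `H` coincide or are adjacent. Only vertices are quantified,
  -- which gives decidability, and `H` may reach outside `Z`, so that atoms can be compared with a
  -- shrinking `W`.
  Convex : (Z H : Subset n) → Set
  Convex Z H = ∀ x y c d → x ∈ₛ H → y ∈ₛ H → x ~ c → Reach (Z ─ H) c d → d ~ y → x ≡ y ⊎ x ~ y

  convex? : ∀ Z H → Dec (Convex Z H)
  convex? Z H = all? λ x → all? λ y → all? λ c → all? λ d →
    x ∈? H →-dec y ∈? H →-dec ~-dec x c →-dec reach? (Z ─ H) c d →-dec ~-dec d y →-dec
      (x ≟ y ⊎-dec ~-dec x y)

  convex⇒isConvex : ∀ {W A} → A ⊆ W → Convex W A → IsConvex G W A
  convex⇒isConvex {W} {A} A⊆W conv = A⊆W , noPath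
    where
    reachLast : ∀ {c y vs} → Walk G W c y vs → c ∉ₛ A → All (_∉ₛ A) vs → ∃[ d ] (Reach (W ─ A) c d × d ~ y)
    reachLast (edge m _ e) c∉ [] = _ , stop (x∈p∧x∉q⇒x∈p─q m c∉) , e
    reachLast (step m e w) c∉ (∉ ∷ ∉s) with reachLast w ∉ ∉s
    ... | d , r , e′ = d , go (x∈p∧x∉q⇒x∈p─q m c∉) e r , e′

    noPath : ∀ x y → x ∈ₛ A → y ∈ₛ A → ¬ x ~ y → ∀ vs → ¬ (Path G W x y vs × All (_∉ₛ A) vs)
    noPath x y x∈ y∈ x≁y [] ((edge _ _ e , _) , _) = x≁y e
    noPath x y x∈ y∈ x≁y (c ∷ vs) (p@(step _ e w , _) , ∉ ∷ ∉s) with reachLast w ∉ ∉s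
    ... | d , r , e′ = [ path⇒≢ p , x≁y ]′ (conv x y c d x∈ y∈ e r e′)

  -- A simple path inside `W ─ A` together with `x` and `y` meets these two only at its ends, so its
  -- internal vertices avoid `A`.
  isConvex⇒convex : ∀ {W A} → IsConvex G W A → Convex W A
  isConvex⇒convex {W} {A} (A⊆W , noPath) x y c d x∈ y∈ e r e′ with x ≟ y | ~-dec x y
  ... | yes x≡y | _      = inj₁ x≡y
  ... | no _    | yes xy = inj₂ xy
  ... | no x≢y  | no x≁y with reach⇒path detour x≢y
    where
    Z : Subset n
    Z = (W ─ A) ∪ (⁅ x ⁆ ∪ ⁅ y ⁆)

    detour : Reach Z x y
    detour = go (q⊆p∪q (W ─ A) _ (p⊆p∪q ⁅ y ⁆ (x∈⁅x⁆ x))) e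
      (reach-snoc (reach-mono (p⊆p∪q _) r) e′ (q⊆p∪q (W ─ A) _ (q⊆p∪q ⁅ x ⁆ ⁅ y ⁆ (x∈⁅x⁆ y))))
  ...   | vs , w , a ∷ u = contradiction
    ((walk-mono Z⊆W w , a ∷ u) ,
     All.zipWith (λ ((m , x≢v) , v≢y) → ∉A m x≢v v≢y)
       (All.zip (walk-internal∈ w , All.++⁻ˡ vs a) , unique-snoc⇒≢ vs u))
    (noPath x y x∈ y∈ x≁y vs)
    where
    Z⊆W : (W ─ A) ∪ (⁅ x ⁆ ∪ ⁅ y ⁆) ⊆ W
    Z⊆W m with x∈p∪q⁻ (W ─ A) _ m
    ... | inj₁ m′ = p─q⊆p W A m′
    ... | inj₂ m′ with x∈p∪q⁻ ⁅ x ⁆ ⁅ y ⁆ m′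
    ...   | inj₁ m″ = subst (_∈ₛ W) (≡-sym (x∈⁅y⁆⇒x≡y x m″)) (A⊆W x∈)
    ...   | inj₂ m″ = subst (_∈ₛ W) (≡-sym (x∈⁅y⁆⇒x≡y y m″)) (A⊆W y∈)

    ∉A : ∀ {v} → v ∈ₛ (W ─ A) ∪ (⁅ x ⁆ ∪ ⁅ y ⁆) → x ≢ v → v ≢ y → v ∉ₛ A
    ∉A m x≢v v≢y with x∈p∪q⁻ (W ─ A) _ m
    ... | inj₁ m′ = x∈p─q⇒x∉q W A m′
    ... | inj₂ m′ with x∈p∪q⁻ ⁅ x ⁆ ⁅ y ⁆ m′
    ...   | inj₁ m″ = contradiction (≡-sym (x∈⁅y⁆⇒x≡y x m″)) x≢v
    ...   | inj₂ m″ = contradiction (x∈⁅y⁆⇒x≡y y m″) v≢y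

  -- Each excursion outside `H` is replaced by the edge or equality that convexity supplies. The
  -- second component is the induction hypothesis in mid-excursion: `H` was left at `h` towards `c`,
  -- and the walk has come to `a`.
  shortcut : ∀ {Z H} → Convex Z H → ∀ {a b} → b ∈ₛ H → Reach Z a b →
             (a ∈ₛ H → Reach (Z ∩ H) a b) ×
             (a ∉ₛ H → ∀ {h c} → h ∈ₛ Z → h ∈ₛ H → h ~ c → Reach (Z ─ H) c a → Reach (Z ∩ H) h b)
  shortcut conv b∈ (stop m) =
    (λ a∈ → stop (x∈p∩q⁺ (m , a∈))) , (λ a∉ → contradiction b∈ a∉)
  shortcut {Z} {H} conv b∈ (go {a} {z} m e r) with shortcut conv b∈ r | z ∈? H
  ... | inH , outH | yes z∈ =
    (λ a∈ → go (x∈p∩q⁺ (m , a∈)) e (inH z∈)) ,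
    (λ a∉ {h} {c} h∈Z h∈H hc s → case-adj h∈Z h∈H (conv h z c a h∈H z∈ hc s e))
    where
    case-adj : ∀ {h} → h ∈ₛ Z → h ∈ₛ H → h ≡ z ⊎ h ~ z → Reach (Z ∩ H) h _
    case-adj _   _   (inj₁ refl) = inH z∈
    case-adj h∈Z h∈H (inj₂ hz)   = go (x∈p∩q⁺ (h∈Z , h∈H)) hz (inH z∈)
  ... | inH , outH | no z∉ =
    (λ a∈ → outH z∉ m a∈ e (stop z∈─)) ,
    (λ a∉ h∈Z h∈H hc s → outH z∉ h∈Z h∈H hc (reach-snoc s e z∈─))
    where
    z∈─ = x∈p∧x∉q⇒x∈p─q (source∈ r) z∉

  convex-mono : ∀ {Z Z′ H} → Z ─ H ⊆ Z′ ─ H → Convex Z′ H → Convex Z H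
  convex-mono i conv x y c d x∈ y∈ xc r dy = conv x y c d x∈ y∈ xc (reach-mono i r) dy

  reach-within-pair : ∀ {Z x y} → Z ⊆ ⁅ x ⁆ ∪ ⁅ y ⁆ → Reach Z x y → x ≡ y ⊎ x ~ y
  reach-within-pair i (stop _) = inj₁ refl
  reach-within-pair {x = x} {y} i (go {z = z} _ e r) with x∈p∪q⁻ ⁅ x ⁆ ⁅ y ⁆ (i (source∈ r))
  ... | inj₂ z∈ rewrite x∈⁅y⁆⇒x≡y y z∈ = inj₂ e
  ... | inj₁ z∈ with x∈⁅y⁆⇒x≡y x z∈
  ...   | refl = reach-within-pair i r

  -- The excursion with its ends is rerouted first through `A`, then through `B`; of `A ∩ B`, the
  -- set `Z` contains only `x` and `y`.
  convex-∩ : ∀ {W A B} → A ⊆ W → Convex W A → Convex W B → Convex W (A ∩ B)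
  convex-∩ {W} {A} {B} A⊆W convA convB x y c d x∈ y∈ xc r dy =
    reach-within-pair Z∩A∩B⊆pair throughA∩B
    where
    pair Z : Subset n
    pair = ⁅ x ⁆ ∪ ⁅ y ⁆
    Z = (W ─ (A ∩ B)) ∪ pair

    x∈A×B = x∈p∩q⁻ A B x∈
    y∈A×B = x∈p∩q⁻ A B y∈

    pair⊆A∩B : pair ⊆ A ∩ B
    pair⊆A∩B m with x∈p∪q⁻ ⁅ x ⁆ ⁅ y ⁆ m
    ... | inj₁ m′ rewrite x∈⁅y⁆⇒x≡y x m′ = x∈
    ... | inj₂ m′ rewrite x∈⁅y⁆⇒x≡y y m′ = y∈

    Z⊆W : Z ⊆ W
    Z⊆W m = [ p─q⊆p W (A ∩ B) , A⊆W ∘ p∩q⊆p A B ∘ pair⊆A∩B ]′ (x∈p∪q⁻ (W ─ (A ∩ B)) pair m)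

    throughZ : Reach Z x y
    throughZ = go (q⊆p∪q (W ─ (A ∩ B)) _ (p⊆p∪q ⁅ y ⁆ (x∈⁅x⁆ x))) xc
      (reach-snoc (reach-mono (p⊆p∪q _) r) dy (q⊆p∪q (W ─ (A ∩ B)) _ (q⊆p∪q ⁅ x ⁆ ⁅ y ⁆ (x∈⁅x⁆ y))))

    throughA : Reach (Z ∩ A) x y
    throughA = proj₁ (shortcut (convex-mono (─-monoˡ-⊆ A Z⊆W) convA) (proj₁ y∈A×B) throughZ) (proj₁ x∈A×B)

    throughA∩B : Reach ((Z ∩ A) ∩ B) x y
    throughA∩B = proj₁
      (shortcut (convex-mono (─-monoˡ-⊆ B (Z⊆W ∘ p∩q⊆p Z A)) convB) (proj₂ y∈A×B) throughA) (proj₂ x∈A×B)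

    Z∩A∩B⊆pair : (Z ∩ A) ∩ B ⊆ pair
    Z∩A∩B⊆pair m with x∈p∩q⁻ (Z ∩ A) B m
    ... | m′ , ∈B with x∈p∩q⁻ Z A m′
    ...   | ∈Z , ∈A with x∈p∪q⁻ (W ─ (A ∩ B)) pair ∈Z
    ...     | inj₁ ∈─ = contradiction (x∈p∩q⁺ (∈A , ∈B)) (x∈p─q⇒x∉q W (A ∩ B) ∈─)
    ...     | inj₂ ∈pair = ∈pair

  convexHull : ∀ {W R} → R ⊆ W → ∃[ H ] IsConvexHull G W R H
  convexHull {W} {R} R⊆W with minimalSubset (λ H → R ⊆? H ×-dec (H ⊆? W ×-dec convex? W H)) W
                               (R⊆W , (λ m → m) , λ x y c d _ _ _ r _ →
                                 contradiction (p─q⊆p W W (source∈ r)) (x∈p─q⇒x∉q W W (source∈ r)))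
  ... | H , _ , (R⊆H , H⊆W , conv) , min =
    H , R⊆H , convex⇒isConvex H⊆W conv ,
    λ H′ R⊆H′ c H′⊆H → min H′ H′⊆H (R⊆H′ , proj₁ c , isConvex⇒convex c)

  -- Minimality is applied to `H ∩ B`, which is convex in `W` even when `B` reaches outside `W`.
  hull⊆convex : ∀ {W R H B} → IsConvexHull G W R H → Convex W B → R ⊆ B → H ⊆ B
  hull⊆convex {W} {R} {H} {B} (R⊆H , c@(H⊆W , _) , min) convB R⊆B =
    p∩q⊆q H B ∘ min (H ∩ B) (λ m → x∈p∩q⁺ (R⊆H m , R⊆B m))
      (convex⇒isConvex (H⊆W ∘ p∩q⊆p H B) (convex-∩ H⊆W (isConvex⇒convex c) convB)) (p∩q⊆p H B)

  -- Clique separators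

  clique? : ∀ W K → Dec (IsClique G W K)
  clique? W K = K ⊆? W ×-dec all? λ x → all? λ y →
    x ∈? K →-dec y ∈? K →-dec ¬? (x ≟ y) →-dec ~-dec x y

  clique-⊆ : ∀ {W K W′ K′} → K′ ⊆ W′ → K′ ⊆ K → IsClique G W K → IsClique G W′ K′
  clique-⊆ K′⊆W′ K′⊆K (_ , c) = K′⊆W′ , λ x y x∈ y∈ → c x y (K′⊆K x∈) (K′⊆K y∈)

  clique-≡⊎~ : ∀ {W K x y} → IsClique G W K → x ∈ₛ K → y ∈ₛ K → x ≡ y ⊎ x ~ y
  clique-≡⊎~ {x = x} {y} (_ , c) x∈ y∈ with x ≟ y
  ... | yes x≡y = inj₁ x≡y
  ... | no x≢y  = inj₂ (c x y x∈ y∈ x≢y)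

  -- `K` ranges over all cliques, minimal separators or not; the empty one accounts for
  -- connectedness. When `R` is smaller than `M`, the connecting walks may still use all of `M`.
  Unseparated : (M R : Subset n) → Set
  Unseparated M R = ∀ K → IsClique G M K → ∀ a b → a ∈ₛ R → b ∈ₛ R → a ∉ₛ K → b ∉ₛ K → Reach (M ─ K) a b

  unseparated? : ∀ M R → Dec (Unseparated M R)
  unseparated? M R = allSubset? λ K → clique? M K →-dec all? λ a → all? λ b →
    a ∈? R →-dec b ∈? R →-dec ¬? (a ∈? K) →-dec ¬? (b ∈? K) →-dec reach? (M ─ K) a b

  -- A clique separating `a` from `b` would contain an inclusion-minimal set separating them, again
  -- a clique.
  candidate⇒unseparated : ∀ {A} → AtomCandidate G A → Unseparated A A
  candidate⇒unseparated {A} (_ , noSep) K cK a b a∈ b∈ a∉ b∉ =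
    decidable-stable (reach? (A ─ K) a b) λ ¬r → absurd (minimalSubset (λ S → ¬? (reach? (A ─ S) a b)) K ¬r)
    where
    absurd : ∃[ S ] (S ⊆ K × (¬ Reach (A ─ S) a b) × (∀ S′ → S′ ⊆ S → ¬ Reach (A ─ S′) a b → S ⊆ S′)) → ⊥
    absurd (S , S⊆K , ¬r , min) = noSep S
      ( clique-⊆ S⊆A S⊆K cK , S⊆A , a , b
      , ¬reach⇒separates (x∈p∧x∉q⇒x∈p─q a∈ (a∉ ∘ S⊆K)) (x∈p∧x∉q⇒x∈p─q b∈ (b∉ ∘ S⊆K)) ¬r
      , λ { S′ (S′⊆S , x , x∈S , x∉S′) sep → x∉S′ (min S′ S′⊆S (separates⇒¬reach sep) x∈S) })
      where
      S⊆A : S ⊆ A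
      S⊆A m = proj₁ cK (S⊆K m)

  unseparated⇒candidate : ∀ {A} → Nonempty A → Unseparated A A → AtomCandidate G A
  unseparated⇒candidate {A} ne un = (ne , connected) , noSep
    where
    connected : ∀ x y → x ∈ₛ A → y ∈ₛ A → x ≢ y → ∃[ vs ] Path G A x y vs
    connected x y x∈ y∈ x≢y = reach⇒path
      (reach-mono (p─q⊆p A ∅) (un ∅ (⊥⊆ , λ _ _ x∈∅ → contradiction x∈∅ ∉⊥) x y x∈ y∈ ∉⊥ ∉⊥)) x≢y

    noSep : ∀ S → ¬ IsCliqueMinimalSeparator G A S
    noSep S (cS , _ , x , y , sep@(x∈ , y∈ , x∉ , y∉ , _) , _) =
      separates⇒¬reach sep (un S cS x y x∈ y∈ x∉ y∉)

  -- Atoms: existence and convexity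

  candidate? : ∀ A → Dec (AtomCandidate G A)
  candidate? A = map′ (λ (ne , un) → unseparated⇒candidate ne un)
    (λ c → proj₁ (proj₁ c) , candidate⇒unseparated c) (nonempty? A ×-dec unseparated? A A)

  candidate⊆atom : ∀ {A} → AtomCandidate G A → ∃[ B ] (A ⊆ B × IsAtom G B)
  candidate⊆atom {A} = maximalSubset candidate? A

  atom⊆atom⇒≡ : ∀ {A B} → IsAtom G A → IsAtom G B → A ⊆ B → A ≡ B
  atom⊆atom⇒≡ (_ , maxA) (cB , _) A⊆B = ⊆-antisym A⊆B (maxA _ A⊆B cB)

  -- A minimal superset of R in which R stays unseparated cannot itself be cut
  -- by a clique K: keeping only K and the side of K meeting R would do as well.
  unseparated⊆candidate : ∀ {X R} → Nonempty R → R ⊆ X → Unseparated X R → ∃[ M ] (R ⊆ M × AtomCandidate G M)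
  unseparated⊆candidate {X} {R} (r , r∈R) R⊆X unX
    with minimalSubset (λ M → R ⊆? M ×-dec unseparated? M R) X (R⊆X , unX)
  ... | M , _ , (R⊆M , unM) , min = M , R⊆M , unseparated⇒candidate (r , R⊆M r∈R) unMM
    where
    module Side (K : Subset n) (cK : IsClique G M K) (s : Fin n)
                (R⊆side : ∀ {z} → z ∈ₛ R → z ∉ₛ K → Reach (M ─ K) s z) where

      side? : ∀ z → Dec (z ∈ₛ K ⊎ Reach (M ─ K) s z)
      side? z = z ∈? K ⊎-dec reach? (M ─ K) s z

      M′ : Subset n
      M′ = comprehension side?

      M′⊆M : M′ ⊆ M
      M′⊆M m = [ proj₁ cK , p─q⊆p M K ∘ target∈ ]′ (∈-comprehension⁻ side? m)

      R⊆M′ : R ⊆ M′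
      R⊆M′ {z} z∈R with z ∈? K
      ... | yes z∈K = ∈-comprehension⁺ side? (inj₁ z∈K)
      ... | no z∉K  = ∈-comprehension⁺ side? (inj₂ (R⊆side z∈R z∉K))

      boundary : ∀ {x c} → x ∈ₛ M′ → c ∈ₛ M → c ∉ₛ M′ → x ~ c → x ∈ₛ K
      boundary x∈ c∈M c∉ xc with ∈-comprehension⁻ side? x∈
      ... | inj₁ x∈K = x∈K
      ... | inj₂ s⇝x = contradiction
        (∈-comprehension⁺ side? (inj₂ (reach-snoc s⇝x xc
          (x∈p∧x∉q⇒x∈p─q c∈M (c∉ ∘ ∈-comprehension⁺ side? ∘ inj₁))))) c∉

      -- Every excursion from `M′` leaves and returns through the clique `K`.
      convexM′ : Convex M M′
      convexM′ x y c d x∈ y∈ xc cd dy = clique-≡⊎~ cK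
        (boundary x∈ (p─q⊆p M M′ (source∈ cd)) (x∈p─q⇒x∉q M M′ (source∈ cd)) xc)
        (boundary y∈ (p─q⊆p M M′ (target∈ cd)) (x∈p─q⇒x∉q M M′ (target∈ cd)) (~-sym dy))

      -- A clique of `M′` is one of `M`; the walk avoiding it in `M` is pulled back into the convex
      -- `M′`.
      unM′ : Unseparated M′ R
      unM′ L cL a b a∈ b∈ a∉ b∉ = reach-mono
        (λ m → x∈p∧x∉q⇒x∈p─q (p∩q⊆q (M ─ L) M′ m) (x∈p─q⇒x∉q M L (p∩q⊆p (M ─ L) M′ m)))
        (proj₁ (shortcut (convex-mono (─-monoˡ-⊆ M′ (p─q⊆p M L)) convexM′) (R⊆M′ b∈)
          (unM L (clique-⊆ (M′⊆M ∘ proj₁ cL) (λ m → m) cL) a b a∈ b∈ a∉ b∉)) (R⊆M′ a∈))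

      s-reaches : ∀ {z} → z ∈ₛ M → z ∉ₛ K → Reach (M ─ K) s z
      s-reaches z∈ z∉ with ∈-comprehension⁻ side? (min M′ M′⊆M (R⊆M′ , unM′) z∈)
      ... | inj₁ z∈K = contradiction z∈K z∉
      ... | inj₂ s⇝z = s⇝z

    unMM : Unseparated M M
    unMM K cK c d c∈ d∈ c∉ d∉ with any? (λ s → s ∈? R ×-dec ¬? (s ∈? K))
    ... | yes (s , s∈R , s∉K) = reach-trans (reach-sym (s-reaches c∈ c∉)) (s-reaches d∈ d∉)
      where open Side K cK s (λ z∈ z∉ → unM K cK s _ s∈R z∈ s∉K z∉)
    -- Here `R` lies in `K`, hence in every side, and `c` itself can serve as `s`.
    ... | no ∄ = s-reaches d∈ d∉
      where open Side K cK c (λ z∈ z∉ → contradiction (_ , z∈ , z∉) ∄)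

  unseparated⊆atom : ∀ {X R} → Nonempty R → R ⊆ X → Unseparated X R → ∃[ B ] (R ⊆ B × IsAtom G B)
  unseparated⊆atom {R = R} ne R⊆X un = extend (unseparated⊆candidate ne R⊆X un)
    where
    enlarge : ∀ {M} → R ⊆ M → ∃[ B ] (M ⊆ B × IsAtom G B) → ∃[ B ] (R ⊆ B × IsAtom G B)
    enlarge R⊆M (B , M⊆B , atomB) = B , M⊆B ∘ R⊆M , atomB

    extend : ∃[ M ] (R ⊆ M × AtomCandidate G M) → ∃[ B ] (R ⊆ B × IsAtom G B)
    extend (M , R⊆M , cM) = enlarge R⊆M (candidate⊆atom cM)

  -- If B is not convex, adding a minimal connection Z between two of its
  -- vertices x, y gives a larger candidate: for q in Z, every clique avoiding q
  -- misses one of the two segments of Z joining q to x and to y.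
  atom-convex : ∀ {W B} → IsAtom G B → Convex W B
  atom-convex {W} {B} (cB , maxB) x y c d x∈ y∈ xc cd dy =
    reach-within-pair Z⊆pair x⇝y
    where
    pair Z₀ : Subset n
    pair = ⁅ x ⁆ ∪ ⁅ y ⁆
    Z₀ = ∁ B ∪ pair

    connection : Reach Z₀ x y
    connection = go (q⊆p∪q (∁ B) pair (p⊆p∪q ⁅ y ⁆ (x∈⁅x⁆ x))) xc
      (reach-snoc (reach-mono (λ m → p⊆p∪q pair (x∉p⇒x∈∁p (x∈p─q⇒x∉q W B m))) cd) dy
        (q⊆p∪q (∁ B) pair (q⊆p∪q ⁅ x ⁆ ⁅ y ⁆ (x∈⁅x⁆ y))))

    minimalConnection = minimalSubset (λ Z → reach? Z x y) Z₀ connection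

    Z : Subset n
    Z = proj₁ minimalConnection

    Z⊆Z₀ : Z ⊆ Z₀
    Z⊆Z₀ = proj₁ (proj₂ minimalConnection)

    x⇝y : Reach Z x y
    x⇝y = proj₁ (proj₂ (proj₂ minimalConnection))

    cutVertex : ∀ {q} → q ∈ₛ Z → ¬ Reach (Z - q) x y
    cutVertex {q} q∈Z r = x∉p-x Z q (proj₂ (proj₂ (proj₂ minimalConnection)) (Z - q) (p─q⊆p Z ⁅ q ⁆) r q∈Z)

    unB : Unseparated B B
    unB = candidate⇒unseparated cB

    module _ (K : Subset n) (cK : IsClique G (B ∪ Z) K) where

      U : Subset n
      U = (B ∪ Z) ─ K

      within : ∀ {q p t} → q ∈ₛ Z → q ∉ₛ K → q ~ p → Reach ((Z - q) ─ K) p t → Reach U q t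
      within {q} q∈Z q∉K qp r = go (x∈p∧x∉q⇒x∈p─q (q⊆p∪q B Z q∈Z) q∉K) qp
        (reach-mono (─-monoˡ-⊆ K (q⊆p∪q B Z ∘ p─q⊆p Z ⁅ q ⁆)) r)

      toB : ∀ q → q ∈ₛ B ∪ Z → q ∉ₛ K → ∃[ b ] (b ∈ₛ B × b ∉ₛ K × Reach U q b)
      toB q q∈ q∉K with q ∈? B | x∈p∪q⁻ B Z q∈
      ... | yes q∈B | _ = q , q∈B , q∉K , stop (x∈p∧x∉q⇒x∈p─q q∈ q∉K)
      ... | no q∉B  | inj₁ q∈B = contradiction q∈B q∉B
      ... | no q∉B  | inj₂ q∈Z
        with leave q (λ { refl → q∉B y∈ }) x⇝y | leave q (λ { refl → q∉B x∈ }) (reach-sym x⇝y)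
      ... | inj₁ r | _ = contradiction r (cutVertex q∈Z)
      ... | inj₂ _ | inj₁ r = contradiction (reach-sym r) (cutVertex q∈Z)
      ... | inj₂ (p , qp , p⇝y) | inj₂ (p′ , qp′ , p′⇝x) with avoid-or-hit K p⇝y | avoid-or-hit K p′⇝x
      ... | inj₁ r | _ = y , y∈ , x∈p─q⇒x∉q (Z - q) K (target∈ r) , within q∈Z q∉K qp r
      ... | inj₂ _ | inj₁ r = x , x∈ , x∈p─q⇒x∉q (Z - q) K (target∈ r) , within q∈Z q∉K qp′ r
      -- If `K` met both segments, the clique would bridge them without `q`, although every walk
      -- from `x` to `y` in `Z` passes through `q`.
      ... | inj₂ (k , k∈K , p⇝k) | inj₂ (k′ , k′∈K , p′⇝k′) = contradiction
        (bridge (clique-≡⊎~ cK k′∈K k∈K)) (cutVertex q∈Z)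
        where
        x⇝k′ = reach-trans (reach-sym p′⇝x) p′⇝k′
        k⇝y = reach-trans (reach-sym p⇝k) p⇝y

        bridge : k′ ≡ k ⊎ k′ ~ k → Reach (Z - q) x y
        bridge (inj₁ refl) = reach-trans x⇝k′ k⇝y
        bridge (inj₂ e)    = reach-trans (reach-snoc x⇝k′ e (source∈ k⇝y)) k⇝y

      unB∪Z : ∀ a b → a ∈ₛ B ∪ Z → b ∈ₛ B ∪ Z → a ∉ₛ K → b ∉ₛ K → Reach U a b
      unB∪Z a b a∈ b∈ a∉ b∉ with toB a a∈ a∉ | toB b b∈ b∉
      ... | a′ , a′∈ , a′∉ , a⇝a′ | b′ , b′∈ , b′∉ , b⇝b′ =
        reach-trans a⇝a′ (reach-trans (reach-mono B─K⊆U a′⇝b′) (reach-sym b⇝b′))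
        where
        a′⇝b′ : Reach (B ─ (B ∩ K)) a′ b′
        a′⇝b′ = unB (B ∩ K) (clique-⊆ (p∩q⊆p B K) (p∩q⊆q B K) cK) a′ b′ a′∈ b′∈
          (a′∉ ∘ p∩q⊆q B K) (b′∉ ∘ p∩q⊆q B K)

        B─K⊆U : B ─ (B ∩ K) ⊆ U
        B─K⊆U m = x∈p∧x∉q⇒x∈p─q (p⊆p∪q Z (p─q⊆p B (B ∩ K) m))
          (λ ∈K → x∈p─q⇒x∉q B (B ∩ K) m (x∈p∩q⁺ (p─q⊆p B (B ∩ K) m , ∈K)))

    -- By maximality of `B`, the candidate `B ∪ Z` adds nothing, so `Z` has no vertex outside `B`.
    Z⊆pair : Z ⊆ pair
    Z⊆pair m with x∈p∪q⁻ (∁ B) pair (Z⊆Z₀ m)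
    ... | inj₂ ∈pair = ∈pair
    ... | inj₁ ∈∁B = contradiction
      (maxB (B ∪ Z) (p⊆p∪q Z) (unseparated⇒candidate (x , p⊆p∪q Z x∈) unB∪Z) (q⊆p∪q B Z m))
      (x∈∁p⇒x∉p ∈∁B)

  -- The vertices of B ∩ H adjacent to the component of B ─ H containing b form
  -- a clique K; were x outside K, K would separate x from b.
  attached : ∀ {W H B b x} → Unseparated B B → B ⊆ W → Convex W H →
             b ∈ₛ B → b ∉ₛ H → x ∈ₛ B → x ∈ₛ H → ∃[ c ] (c ∈ₛ B ─ H × c ~ x)
  attached {W} {H} {B} {b} {x} unB B⊆W conv b∈B b∉H x∈B x∈H =
    let _ , _ , c , b⇝c , cx = ∈-comprehension⁻ boundary? x∈K in c , target∈ b⇝c , cx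
    where
    boundary? : ∀ k → Dec (k ∈ₛ B × k ∈ₛ H × ∃[ c ] (Reach (B ─ H) b c × c ~ k))
    boundary? k = k ∈? B ×-dec k ∈? H ×-dec any? λ c → reach? (B ─ H) b c ×-dec ~-dec c k

    K : Subset n
    K = comprehension boundary?

    b∉K : b ∉ₛ K
    b∉K m = b∉H (proj₁ (proj₂ (∈-comprehension⁻ boundary? m)))

    cliqueK : IsClique G B K
    cliqueK = (λ m → proj₁ (∈-comprehension⁻ boundary? m)) , adjacent
      where
      adjacent : ∀ k k′ → k ∈ₛ K → k′ ∈ₛ K → k ≢ k′ → k ~ k′
      adjacent k k′ k∈ k′∈ k≢k′ with ∈-comprehension⁻ boundary? k∈ | ∈-comprehension⁻ boundary? k′∈
      ... | _ , k∈H , c , b⇝c , ck | _ , k′∈H , c′ , b⇝c′ , c′k′ =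
        [ (λ eq → contradiction eq k≢k′) , id ]′
          (conv k k′ c c′ k∈H k′∈H (~-sym ck)
            (reach-mono (─-monoˡ-⊆ H B⊆W) (reach-trans (reach-sym b⇝c) b⇝c′)) c′k′)

    -- Induction from the end `b`: a vertex of `H` next to the component of `b` would belong to `K`.
    stays : ∀ {z} → Reach (B ─ K) z b → Reach (B ─ H) z b
    stays (stop _) = stop (x∈p∧x∉q⇒x∈p─q b∈B b∉H)
    stays (go {z} m e r) with stays r | z ∈? H
    ... | s | no z∉H  = go (x∈p∧x∉q⇒x∈p─q (p─q⊆p B K m) z∉H) e s
    ... | s | yes z∈H = contradiction
      (∈-comprehension⁺ boundary? (p─q⊆p B K m , z∈H , _ , reach-sym s , ~-sym e)) (x∈p─q⇒x∉q B K m)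

    x∈K : x ∈ₛ K
    x∈K = decidable-stable (x ∈? K) λ x∉K →
      x∈p─q⇒x∉q B H (source∈ (stays (unB K cliqueK x b x∈B b∈B x∉K b∉K))) x∈H

  -- Membership in closed neighbourhoods

  module _ {W A : Subset n} {y : Fin n} where

    private
      neighbour? : Dec (∃[ w ] (w ∈ₛ A × w ∈ₛ W × w ~ y))
      neighbour? = any? λ w → (w ∈? A) ×-dec ((w ∈? W) ×-dec T? (adj G w y))

    ∈-closedNbhd⁺ : y ∈ₛ W → y ∈ₛ A ⊎ ∃[ w ] (w ∈ₛ A × w ∈ₛ W × w ~ y) → y ∈ₛ closedNbhd G W A
    ∈-closedNbhd⁺ y∈W h = ∈-tabulate⁺ (Equivalence.from (T-∧ {isYes (y ∈? W)})
      ( fromWitness {a? = y ∈? W} y∈W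
      , Equivalence.from (T-∨ {isYes (y ∈? A)} {isYes neighbour?})
          (Sum.map (fromWitness {a? = y ∈? A}) (fromWitness {a? = neighbour?}) h)))

    ∈-closedNbhd⁻ : y ∈ₛ closedNbhd G W A → y ∈ₛ W × (y ∈ₛ A ⊎ ∃[ w ] (w ∈ₛ A × w ∈ₛ W × w ~ y))
    ∈-closedNbhd⁻ m with Equivalence.to (T-∧ {isYes (y ∈? W)}) (∈-tabulate⁻ m)
    ... | t , u = toWitness {a? = y ∈? W} t ,
      Sum.map (toWitness {a? = y ∈? A}) (toWitness {a? = neighbour?})
        (Equivalence.to (T-∨ {isYes (y ∈? A)} {isYes neighbour?}) u)

  ∈-closedNbhd-vertex⁻ : ∀ {W v y} → y ∈ₛ closedNbhd G W ⁅ v ⁆ → y ∈ₛ W × (y ≡ v ⊎ v ~ y)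
  ∈-closedNbhd-vertex⁻ {v = v} m with ∈-closedNbhd⁻ m
  ... | y∈W , inj₁ y∈ = y∈W , inj₁ (x∈⁅y⁆⇒x≡y v y∈)
  ... | y∈W , inj₂ (w , w∈ , _ , wy) with x∈⁅y⁆⇒x≡y v w∈
  ...   | refl = y∈W , inj₂ wy

  ∈-closedNbhd-vertex⁺ : ∀ {W v y} → v ∈ₛ W → y ∈ₛ W → y ≡ v ⊎ v ~ y → y ∈ₛ closedNbhd G W ⁅ v ⁆
  ∈-closedNbhd-vertex⁺ {v = v} v∈W y∈W (inj₁ refl) = ∈-closedNbhd⁺ y∈W (inj₁ (x∈⁅x⁆ v))
  ∈-closedNbhd-vertex⁺ {v = v} v∈W y∈W (inj₂ vy)   = ∈-closedNbhd⁺ y∈W (inj₂ (v , x∈⁅x⁆ v , v∈W , vy))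

  -- The algorithm

  remainder : (W H : Subset n) → Subset n
  remainder W H = closedNbhd G W (W ─ H)

  -- All neighbours of `v` in `W` lie in `H`. This makes the loop terminate and shows that an atom
  -- containing `v` cannot survive.
  v∉remainder : ∀ {W H v} → v ∈ₛ W → closedNbhd G W ⁅ v ⁆ ⊆ H → v ∉ₛ remainder W H
  v∉remainder {W} {H} v∈W N⊆H m with ∈-closedNbhd⁻ m
  ... | _ , inj₁ v∈─ = x∈p─q⇒x∉q W H v∈─ (N⊆H (∈-closedNbhd-vertex⁺ v∈W v∈W (inj₁ refl)))
  ... | _ , inj₂ (w , w∈─ , w∈W , wv) =
    x∈p─q⇒x∉q W H w∈─ (N⊆H (∈-closedNbhd-vertex⁺ v∈W w∈W (inj₂ (~-sym wv))))

  -- Once some vertex of `B` lies outside `H`, `attached` gives every vertex of `B` inside `H` a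
  -- neighbour in `B ─ H`.
  candidate-step : ∀ {W H B} → Convex W H → AtomCandidate G B → B ⊆ W → B ⊆ H ⊎ B ⊆ remainder W H
  candidate-step {W} {H} {B} conv cB B⊆W with B ⊆? H
  ... | yes B⊆H = inj₁ B⊆H
  ... | no B⊈H with p⊈q⇒∃ B⊈H
  ...   | b , b∈B , b∉H = inj₂ λ {x} x∈B → ∈-closedNbhd⁺ (B⊆W x∈B) (reason x∈B)
    where
    reason : ∀ {x} → x ∈ₛ B → x ∈ₛ W ─ H ⊎ ∃[ w ] (w ∈ₛ W ─ H × w ∈ₛ W × w ~ x)
    reason {x} x∈B with x ∈? H
    ... | no x∉H = inj₁ (x∈p∧x∉q⇒x∈p─q (B⊆W x∈B) x∉H)
    ... | yes x∈H = inj₂ (fromAttached (attached (candidate⇒unseparated cB) B⊆W conv b∈B b∉H x∈B x∈H))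
      where
      fromAttached : ∃[ c ] (c ∈ₛ B ─ H × c ~ x) → ∃[ w ] (w ∈ₛ W ─ H × w ∈ₛ W × w ~ x)
      fromAttached (c , c∈ , cx) = c , ─-monoˡ-⊆ H B⊆W c∈ , B⊆W (p─q⊆p B H c∈) , cx

  remainder⊂ : ∀ {W H v} → v ∈ₛ W → closedNbhd G W ⁅ v ⁆ ⊆ H → remainder W H ⊂ W
  remainder⊂ v∈W N⊆H = (proj₁ ∘ ∈-closedNbhd⁻) , _ , v∈W , v∉remainder v∈W N⊆H

  module _ (α : Fin n → Fin n) where

    smallest : ∀ {W} → Nonempty W → ∃[ v ] (v ∈ₛ W × (∀ u → u ∈ₛ W → toℕ (α v) ℕ.≤ toℕ (α u)))
    smallest {W} (x , x∈W) = descend (toℕ (α x)) x x∈W ℕ.≤-refl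
      where
      descend : ∀ k x → x ∈ₛ W → toℕ (α x) ℕ.≤ k → ∃[ v ] (v ∈ₛ W × (∀ u → u ∈ₛ W → toℕ (α v) ℕ.≤ toℕ (α u)))
      descend k x x∈W αx≤k with any? (λ y → y ∈? W ×-dec toℕ (α y) ℕ.<? toℕ (α x))
      ... | no ∄ = x , x∈W , λ u u∈W → ℕ.≮⇒≥ (λ lt → ∄ (u , u∈W , lt))
      descend zero    x x∈W αx≤k | yes (y , y∈W , lt) = contradiction (ℕ.<-≤-trans lt αx≤k) ℕ.n≮0
      descend (suc k) x x∈W αx≤k | yes (y , y∈W , lt) =
        descend k y y∈W (ℕ.s≤s⁻¹ (ℕ.<-≤-trans lt αx≤k))

    run : ∀ W 𝒰 → ∃[ 𝒰f ] RDA G α W 𝒰 𝒰f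
    run W 𝒰 = loop W 𝒰 (⊂-wellFounded W)
      where
      loop : ∀ W 𝒰 → Acc _⊂_ W → ∃[ 𝒰f ] RDA G α W 𝒰 𝒰f
      loop W 𝒰 (acc rs) with nonempty? W
      ... | no empty = 𝒰 , done empty
      ... | yes ne with smallest ne
      ...   | v , v∈W , min with convexHull (λ m → proj₁ (∈-closedNbhd-vertex⁻ {W} {v} m))
      ...     | H , hull@(N⊆H , _) with Any.any? (H ⊆?_) 𝒰
      ...       | yes H⊆some =
        let 𝒰f , r = loop (remainder W H) 𝒰 (rs (remainder⊂ v∈W N⊆H))
        in 𝒰f , skip v H v∈W min hull (find H⊆some) r
      ...       | no H⊈any =
        let 𝒰f , r = loop (remainder W H) (𝒰 ++ [ H ]) (rs (remainder⊂ v∈W N⊆H))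
        in 𝒰f , add v H v∈W min hull (λ U U∈𝒰 H⊆U → H⊈any (lose U∈𝒰 H⊆U)) r

  -- Maximum cardinality search

  module _ (α : Fin n → Fin n) (mcs : IsMCSOrdering G α) where

    -- Numbers are given downwards, so these are the vertices numbered by the time `k` has been
    -- assigned; for `k = n` there are none.
    numberedFrom : ℕ → Subset n
    numberedFrom k = comprehension λ x → k ℕ.≤? toℕ (α x)

    numberedFrom⁺ : ∀ {k x} → k ℕ.≤ toℕ (α x) → x ∈ₛ numberedFrom k
    numberedFrom⁺ = ∈-comprehension⁺ _

    numberedFrom⁻ : ∀ {k x} → x ∈ₛ numberedFrom k → k ℕ.≤ toℕ (α x)
    numberedFrom⁻ = ∈-comprehension⁻ _

    numberedFrom-suc⊆ : ∀ k → numberedFrom (suc k) ⊆ numberedFrom k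
    numberedFrom-suc⊆ k m = numberedFrom⁺ (ℕ.<⇒≤ (numberedFrom⁻ m))

    numberedFrom-step : ∀ {k z} → toℕ (α z) ≡ k → ∀ {x} → x ∈ₛ numberedFrom k → x ≢ z → x ∈ₛ numberedFrom (suc k)
    numberedFrom-step refl {x} m x≢z = numberedFrom⁺ (ℕ.≤∧≢⇒< (numberedFrom⁻ m)
      (λ eq → x≢z (≡-sym (proj₁ (proj₁ mcs) (toℕ-injective eq)))))

    -- `w` ranges over the vertices still unnumbered. Both sides count numbered vertices only, so
    -- the bound can be followed through the search.
    CutBound : (S D : Subset n) → ℕ → Set
    CutBound S D k = ∀ w → toℕ (α w) ℕ.< k →
      ∣ nbhd G w ∩ ((D ∪ S) ∩ numberedFrom k) ∣ ℕ.≤ ∣ S ∩ numberedFrom k ∣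

    -- One step of the search: `z` receives the number `k`, taking `X` to `X⁺`.
    module _ {S : Subset n} {k : ℕ} {z : Fin n} (αz≡k : toℕ (α z) ≡ k) where

      private
        X X⁺ : Subset n
        X  = numberedFrom (suc k)
        X⁺ = numberedFrom k

        grow-S : ∣ S ∩ X ∣ ℕ.≤ ∣ S ∩ X⁺ ∣
        grow-S = p⊆q⇒∣p∣≤∣q∣ λ m →
          x∈p∩q⁺ (p∩q⊆p S X m , numberedFrom-suc⊆ k (p∩q⊆q S X m))

        shrink : ∀ {D w x} → x ≢ z → x ∈ₛ nbhd G w ∩ ((D ∪ S) ∩ X⁺) → x ∈ₛ nbhd G w ∩ ((D ∪ S) ∩ X)
        shrink {D} {w} x≢z m with x∈p∩q⁻ (nbhd G w) _ m
        ... | ∈N , m′ with x∈p∩q⁻ (D ∪ S) X⁺ m′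
        ...   | ∈D∪S , ∈X⁺ = x∈p∩q⁺ (∈N , x∈p∩q⁺ (∈D∪S , numberedFrom-step αz≡k ∈X⁺ x≢z))

        shrink-∉ : ∀ {D} w → z ∉ₛ D ∪ S → nbhd G w ∩ ((D ∪ S) ∩ X⁺) ⊆ nbhd G w ∩ ((D ∪ S) ∩ X)
        shrink-∉ {D} w z∉ m = shrink {D}
          (λ { refl → z∉ (p∩q⊆p (D ∪ S) X⁺ (p∩q⊆q (nbhd G w) _ m)) }) m

      cutBound-keep : ∀ {D} → z ∉ₛ D ∪ S → CutBound S D (suc k) → CutBound S D k
      cutBound-keep z∉ bound w αw<k = ℕ.≤-trans (p⊆q⇒∣p∣≤∣q∣ (shrink-∉ w z∉))
        (ℕ.≤-trans (bound w (ℕ.m<n⇒m<1+n αw<k)) grow-S)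

      -- The left count rises by at most one, and the right count rises because `z` is new in
      -- `S ∩ X⁺`.
      cutBound-grow : ∀ {D} → z ∈ₛ S → CutBound S D (suc k) → CutBound S D k
      cutBound-grow {D} z∈S bound w αw<k = begin
        ∣ nbhd G w ∩ ((D ∪ S) ∩ X⁺) ∣           ≤⟨ ∣p∣≤1+∣p-x∣ N z ⟩
        suc ∣ (nbhd G w ∩ ((D ∪ S) ∩ X⁺)) - z ∣ ≤⟨ s≤s (p⊆q⇒∣p∣≤∣q∣ remove) ⟩
        suc ∣ nbhd G w ∩ ((D ∪ S) ∩ X) ∣        ≤⟨ s≤s (bound w (ℕ.m<n⇒m<1+n αw<k)) ⟩
        suc ∣ S ∩ X ∣                           ≤⟨ p⊂q⇒∣p∣<∣q∣ S∩X⊂S∩X⁺ ⟩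
        ∣ S ∩ X⁺ ∣                              ∎
        where
        open ℕ.≤-Reasoning

        N : Subset n
        N = nbhd G w ∩ ((D ∪ S) ∩ X⁺)

        remove : N - z ⊆ nbhd G w ∩ ((D ∪ S) ∩ X)
        remove m = shrink {D} {w} (x∉⁅y⁆⇒x≢y (x∈p─q⇒x∉q N ⁅ z ⁆ m)) (p─q⊆p N ⁅ z ⁆ m)

        S∩X⊂S∩X⁺ : S ∩ X ⊂ S ∩ X⁺
        S∩X⊂S∩X⁺ =
          (λ m → x∈p∩q⁺ (p∩q⊆p S X m , numberedFrom-suc⊆ k (p∩q⊆q S X m))) ,
          z , x∈p∩q⁺ (z∈S , numberedFrom⁺ (ℕ.≤-reflexive (≡-sym αz≡k))) ,
          λ m → ℕ.<-irrefl (≡-sym αz≡k) (numberedFrom⁻ (p∩q⊆q S X m))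

      -- z has no neighbours in D, so its weight is bounded by |S ∩ X|, and z has
      -- maximum weight among the vertices not numbered yet.
      cutBound-switch : ∀ {D E} → z ∉ₛ D ∪ S →
        (∀ x → x ∈ₛ X → z ~ x → x ∈ₛ E ∪ S) → CutBound S E (suc k) → CutBound S D k
      cutBound-switch {D} {E} z∉ nbrs bound w αw<k = begin
        ∣ nbhd G w ∩ ((D ∪ S) ∩ X⁺) ∣ ≤⟨ p⊆q⇒∣p∣≤∣q∣ toWeight ⟩
        weight G α z w                ≤⟨ proj₂ mcs z w (subst (toℕ (α w) ℕ.<_) (≡-sym αz≡k) αw<k) ⟩
        weight G α z z                ≤⟨ p⊆q⇒∣p∣≤∣q∣ fromWeight ⟩
        ∣ nbhd G z ∩ ((E ∪ S) ∩ X) ∣  ≤⟨ bound z (s≤s (ℕ.≤-reflexive αz≡k)) ⟩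
        ∣ S ∩ X ∣                     ≤⟨ grow-S ⟩
        ∣ S ∩ X⁺ ∣                    ∎
        where
        open ℕ.≤-Reasoning

        toWeight : nbhd G w ∩ ((D ∪ S) ∩ X⁺) ⊆ nbhd G w ∩ numberedBefore G α z
        toWeight m with x∈p∩q⁻ (nbhd G w) _ (shrink-∉ {D} w z∉ m)
        ... | ∈N , m′ = x∈p∩q⁺ (∈N , ∈-tabulate⁺ (fromWitness
          (subst (ℕ._< _) (≡-sym αz≡k) (numberedFrom⁻ (p∩q⊆q (D ∪ S) X m′)))))

        fromWeight : nbhd G z ∩ numberedBefore G α z ⊆ nbhd G z ∩ ((E ∪ S) ∩ X)
        fromWeight m with x∈p∩q⁻ (nbhd G z) _ m
        ... | ∈N , ∈B = x∈p∩q⁺ (∈N , x∈p∩q⁺ (nbrs _ ∈X (∈-tabulate⁻ ∈N) , ∈X))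
          where
          ∈X = numberedFrom⁺ (subst (ℕ._< _) αz≡k (toWitness (∈-tabulate⁻ ∈B)))

    -- Once a vertex z of E is numbered, no vertex w has more than |S| neighbours
    -- in D ∪ S until the search returns to D, and conversely.
    cut : ∀ {S D E} l →
      (∀ x → x ∈ₛ numberedFrom l → x ∈ₛ S ⊎ x ∈ₛ D ⊎ x ∈ₛ E) →
      (∀ {x} → x ∈ₛ D → x ∉ₛ E ∪ S) → (∀ {x} → x ∈ₛ E → x ∉ₛ D ∪ S) →
      (∀ {d e} → d ∈ₛ D → e ∈ₛ E → ¬ d ~ e) →
      ∀ j k → j ℕ.+ k ≡ n → l ℕ.≤ k → CutBound S D k ⊎ CutBound S E k
    -- `j` counts the numbered vertices. At the start nothing is numbered and the bound is trivial.
    cut {S} {D} l cover D∉ E∉ D≁E zero k refl l≤k = inj₁ λ w _ →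
      p⊆q⇒∣p∣≤∣q∣ {q = S ∩ numberedFrom k} λ {x} m → contradiction (toℕ<n (α x))
        (ℕ.≤⇒≯ (numberedFrom⁻ (p∩q⊆q (D ∪ S) (numberedFrom k) (p∩q⊆q (nbhd G w) _ m))))
    cut {S} {D} {E} l cover D∉ E∉ D≁E (suc j) k eq l≤k
      with cut l cover D∉ E∉ D≁E j (suc k) (≡-trans (ℕ.+-suc j k) eq) (ℕ.m≤n⇒m≤1+n l≤k)
    ... | bounds = extend (cover z (numberedFrom⁺ (subst (l ℕ.≤_) (≡-sym αz≡k) l≤k))) bounds
      where
      k<n : k ℕ.< n
      k<n = subst (k ℕ.<_) eq (s≤s (ℕ.m≤n+m k j))

      z : Fin n
      z = proj₁ (proj₂ (proj₁ mcs) (fromℕ< k<n))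

      αz≡k : toℕ (α z) ≡ k
      αz≡k = ≡-trans (cong toℕ (proj₂ (proj₂ (proj₁ mcs) (fromℕ< k<n)) refl)) (toℕ-fromℕ< k<n)

      covered : ∀ {x} → x ∈ₛ numberedFrom (suc k) → x ∈ₛ S ⊎ x ∈ₛ D ⊎ x ∈ₛ E
      covered m = cover _ (numberedFrom⁺ (ℕ.≤-trans (ℕ.m≤n⇒m≤1+n l≤k) (numberedFrom⁻ m)))

      nbrs-E : z ∈ₛ E → ∀ x → x ∈ₛ numberedFrom (suc k) → z ~ x → x ∈ₛ E ∪ S
      nbrs-E z∈E x m zx with covered m
      ... | inj₁ x∈S = q⊆p∪q E S x∈S
      ... | inj₂ (inj₁ x∈D) = contradiction (~-sym zx) (D≁E x∈D z∈E)
      ... | inj₂ (inj₂ x∈E) = p⊆p∪q S x∈E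

      nbrs-D : z ∈ₛ D → ∀ x → x ∈ₛ numberedFrom (suc k) → z ~ x → x ∈ₛ D ∪ S
      nbrs-D z∈D x m zx with covered m
      ... | inj₁ x∈S = q⊆p∪q D S x∈S
      ... | inj₂ (inj₁ x∈D) = p⊆p∪q S x∈D
      ... | inj₂ (inj₂ x∈E) = contradiction zx (D≁E z∈D x∈E)

      -- If `z` falls on the bounded side, the bound passes to the other side; otherwise it stays.
      extend : z ∈ₛ S ⊎ z ∈ₛ D ⊎ z ∈ₛ E →
        CutBound S D (suc k) ⊎ CutBound S E (suc k) → CutBound S D k ⊎ CutBound S E k
      extend (inj₁ z∈S) (inj₁ b) = inj₁ (cutBound-grow αz≡k z∈S b)
      extend (inj₁ z∈S) (inj₂ b) = inj₂ (cutBound-grow αz≡k z∈S b)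
      extend (inj₂ (inj₁ z∈D)) (inj₁ b) = inj₂ (cutBound-switch αz≡k (D∉ z∈D) (nbrs-D z∈D) b)
      extend (inj₂ (inj₁ z∈D)) (inj₂ b) = inj₂ (cutBound-keep αz≡k (D∉ z∈D) b)
      extend (inj₂ (inj₂ z∈E)) (inj₁ b) = inj₁ (cutBound-keep αz≡k (E∉ z∈E) b)
      extend (inj₂ (inj₂ z∈E)) (inj₂ b) = inj₁ (cutBound-switch αz≡k (E∉ z∈E) (nbrs-E z∈E) b)

    module _ (v : Fin n) where

      private
        l : ℕ
        -- At `l` the vertex `v` is the next to be numbered, whereas `X` already contains it.
        l = suc (toℕ (α v))

        X : Subset n
        X = numberedFrom (toℕ (α v))

        v∈X : v ∈ₛ X
        v∈X = numberedFrom⁺ ℕ.≤-refl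

      -- `v` is adjacent to all numbered vertices of `S`, being itself still unnumbered, and `a` is
      -- one neighbour too many.
      ¬cutBound : ∀ {S D a} → (∀ {x} → x ∈ₛ S → x ≢ v → v ~ x) →
        a ∈ₛ D → a ∉ₛ S → v ~ a → a ∈ₛ numberedFrom l → ¬ CutBound S D l
      ¬cutBound {S} {D} {a} v~S a∈D a∉S va a∈l bound =
        ℕ.<⇒≱ (p⊂q⇒∣p∣<∣q∣ strict) (bound v ℕ.≤-refl)
        where
        strict : S ∩ numberedFrom l ⊂ nbhd G v ∩ ((D ∪ S) ∩ numberedFrom l)
        strict =
          (λ m → let x∈S , x∈l = x∈p∩q⁻ S _ m in
            x∈p∩q⁺ ( ∈-tabulate⁺ (v~S x∈S λ { refl → ℕ.<-irrefl refl (numberedFrom⁻ x∈l) })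
                   , x∈p∩q⁺ (q⊆p∪q D S x∈S , x∈l))) ,
          a , x∈p∩q⁺ (∈-tabulate⁺ va , x∈p∩q⁺ (p⊆p∪q S a∈D , a∈l)) , a∉S ∘ p∩q⊆p S _

      -- Otherwise let `D` be the component of `a` in `X ─ K` and `E` the rest, with `b`. Whichever
      -- side `cut` bounds, the neighbour `a` or `b` of `v` violates the bound.
      nbhd-unseparated-∈ : ∀ K → IsClique G X K → v ∈ₛ K → ∀ a b → a ∈ₛ X → b ∈ₛ X →
        v ~ a → v ~ b → a ∉ₛ K → b ∉ₛ K → Reach (X ─ K) a b
      nbhd-unseparated-∈ K cK v∈K a b a∈X b∈X va vb a∉K b∉K =
        decidable-stable (reach? (X ─ K) a b) λ ¬r →
          [ ¬cutBound v~K (∈-comprehension⁺ _ (stop (x∈p∧x∉q⇒x∈p─q a∈X a∉K))) a∉K va (later a∈X a∉K)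
          , ¬cutBound v~K (∈-comprehension⁺ E? (x∈p∧x∉q⇒x∈p─q b∈X b∉K , ¬r)) b∉K vb (later b∈X b∉K)
          ]′ (cut l cover D∉ E∉ D≁E (n ℕ.∸ l) l (ℕ.m∸n+n≡m (toℕ<n (α v))) ℕ.≤-refl)
        where
        v~K : ∀ {x} → x ∈ₛ K → x ≢ v → v ~ x
        v~K x∈K x≢v = proj₂ cK v _ v∈K x∈K (≢-sym x≢v)

        later : ∀ {x} → x ∈ₛ X → x ∉ₛ K → x ∈ₛ numberedFrom l
        later x∈X x∉K = numberedFrom-step refl x∈X (λ { refl → x∉K v∈K })

        D? : ∀ x → Dec (Reach (X ─ K) a x)
        D? = reach? (X ─ K) a

        E? : ∀ x → Dec (x ∈ₛ X ─ K × ¬ Reach (X ─ K) a x)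
        E? x = x ∈? (X ─ K) ×-dec ¬? (D? x)

        D E : Subset n
        D = comprehension D?
        E = comprehension E?

        cover : ∀ x → x ∈ₛ numberedFrom l → x ∈ₛ K ⊎ x ∈ₛ D ⊎ x ∈ₛ E
        cover x m with x ∈? K | D? x
        ... | yes x∈K | _     = inj₁ x∈K
        ... | no _    | yes r = inj₂ (inj₁ (∈-comprehension⁺ D? r))
        ... | no x∉K  | no ¬r = inj₂ (inj₂ (∈-comprehension⁺ E?
          (x∈p∧x∉q⇒x∈p─q (numberedFrom-suc⊆ _ m) x∉K , ¬r)))

        D∉ : ∀ {x} → x ∈ₛ D → x ∉ₛ E ∪ K
        D∉ x∈D m with ∈-comprehension⁻ D? x∈D | x∈p∪q⁻ E K m
        ... | r | inj₁ x∈E = proj₂ (∈-comprehension⁻ E? x∈E) r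
        ... | r | inj₂ x∈K = x∈p─q⇒x∉q X K (target∈ r) x∈K

        E∉ : ∀ {x} → x ∈ₛ E → x ∉ₛ D ∪ K
        E∉ x∈E m with ∈-comprehension⁻ E? x∈E | x∈p∪q⁻ D K m
        ... | _ , ¬r | inj₁ x∈D = ¬r (∈-comprehension⁻ D? x∈D)
        ... | ∈─ , _ | inj₂ x∈K = x∈p─q⇒x∉q X K ∈─ x∈K

        D≁E : ∀ {d e} → d ∈ₛ D → e ∈ₛ E → ¬ d ~ e
        D≁E d∈D e∈E de with ∈-comprehension⁻ D? d∈D | ∈-comprehension⁻ E? e∈E
        ... | r | e∈─ , ¬r = ¬r (reach-snoc r de e∈─)

      nbhd-unseparated : Unseparated X (closedNbhd G X ⁅ v ⁆)
      nbhd-unseparated K cK a b a∈ b∈ a∉K b∉K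
        with ∈-closedNbhd-vertex⁻ a∈ | ∈-closedNbhd-vertex⁻ b∈ | v ∈? K
      ... | a∈X , va | b∈X , vb | no v∉K = reach-trans (reach-sym (fromV a∈X a∉K va)) (fromV b∈X b∉K vb)
        where
        fromV : ∀ {y} → y ∈ₛ X → y ∉ₛ K → y ≡ v ⊎ v ~ y → Reach (X ─ K) v y
        fromV y∈X y∉K (inj₁ refl) = stop (x∈p∧x∉q⇒x∈p─q y∈X y∉K)
        fromV y∈X y∉K (inj₂ vy)   = go (x∈p∧x∉q⇒x∈p─q v∈X v∉K) vy (stop (x∈p∧x∉q⇒x∈p─q y∈X y∉K))
      ... | a∈X , inj₁ refl | b∈X , vb | yes v∈K = contradiction v∈K a∉K
      ... | a∈X , inj₂ va | b∈X , inj₁ refl | yes v∈K = contradiction v∈K b∉K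
      ... | a∈X , inj₂ va | b∈X , inj₂ vb | yes v∈K =
        nbhd-unseparated-∈ K cK v∈K a b a∈X b∈X va vb a∉K b∉K

      -- The choice of `v` puts `W` inside `X`, where the search argument applies.
      nbhd⊆atom : ∀ {W} → v ∈ₛ W → (∀ u → u ∈ₛ W → toℕ (α v) ℕ.≤ toℕ (α u)) →
        ∃[ B ] (closedNbhd G W ⁅ v ⁆ ⊆ B × IsAtom G B)
      nbhd⊆atom {W} v∈W min = restrict
        (unseparated⊆atom (v , ∈-closedNbhd-vertex⁺ v∈X v∈X (inj₁ refl)) (proj₁ ∘ ∈-closedNbhd-vertex⁻) nbhd-unseparated)
        where
        restrict : ∃[ B ] (closedNbhd G X ⁅ v ⁆ ⊆ B × IsAtom G B) → ∃[ B ] (closedNbhd G W ⁅ v ⁆ ⊆ B × IsAtom G B)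
        restrict (B , N⊆B , atomB) = B , (λ m → let y∈W , vy = ∈-closedNbhd-vertex⁻ m in
          N⊆B (∈-closedNbhd-vertex⁺ v∈X (numberedFrom⁺ (min _ y∈W)) vy)) , atomB

    -- Loop invariant and correctness of the output

    record Invariant (W : Subset n) (𝒰 : List (Subset n)) : Set where
      field
        sound    : ∀ U → U ∈ 𝒰 → IsAtom G U
        complete : ∀ B → IsAtom G B → B ∈ 𝒰 ⊎ B ⊆ W

    open Invariant

    invariant⇒atoms : ∀ {W 𝒰 𝒰f} → Invariant W 𝒰 → RDA G α W 𝒰 𝒰f → ∀ A → A ∈ 𝒰f ⇔ IsAtom G A
    invariant⇒atoms {W} {𝒰} inv (done empty) A = mk⇔ (sound inv A) λ atomA →
      [ id , (λ A⊆W → let (x , x∈A) , _ = proj₁ (proj₁ atomA) in contradiction (x , A⊆W x∈A) empty) ]′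
        (complete inv A atomA)
    invariant⇒atoms {W} {𝒰} inv (skip v H v∈W _ (_ , convH , _) (U , U∈𝒰 , H⊆U) run) =
      invariant⇒atoms (record { sound = sound inv ; complete = complete′ }) run
      where
      complete′ : ∀ B → IsAtom G B → B ∈ 𝒰 ⊎ B ⊆ remainder W H
      complete′ B atomB with complete inv B atomB
      ... | inj₁ B∈𝒰 = inj₁ B∈𝒰
      ... | inj₂ B⊆W with candidate-step (isConvex⇒convex convH) (proj₁ atomB) B⊆W
      ...   | inj₂ B⊆W′ = inj₂ B⊆W′
      -- An atom inside `H` is inside the listed atom `U`, hence equal to it.
      ...   | inj₁ B⊆H rewrite atom⊆atom⇒≡ atomB (sound inv U U∈𝒰) (H⊆U ∘ B⊆H) = inj₁ U∈𝒰
    invariant⇒atoms {W} {𝒰} inv (add v H v∈W min hull@(N⊆H , convH , _) new run) =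
      invariant⇒atoms (record { sound = sound′ ; complete = complete′ }) run
      where
      fromAtom : ∃[ B ] (closedNbhd G W ⁅ v ⁆ ⊆ B × IsAtom G B) → IsAtom G H
      fromAtom (B , N⊆B , atomB) = conclude (complete inv B atomB)
        where
        H⊆B : H ⊆ B
        H⊆B = hull⊆convex hull (atom-convex atomB) N⊆B

        swallowed : B ⊆ H ⊎ B ⊆ remainder W H → IsAtom G H
        swallowed (inj₁ B⊆H)  = subst (IsAtom G) (⊆-antisym B⊆H H⊆B) atomB
        swallowed (inj₂ B⊆W′) = contradiction
          (B⊆W′ (N⊆B (∈-closedNbhd-vertex⁺ v∈W v∈W (inj₁ refl)))) (v∉remainder v∈W N⊆H)

        conclude : B ∈ 𝒰 ⊎ B ⊆ W → IsAtom G H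
        -- An atom `B` already listed would contain `H`, against the test that admits `H`.
        conclude (inj₁ B∈𝒰) = ⊥-elim (new B B∈𝒰 H⊆B)
        conclude (inj₂ B⊆W) = swallowed (candidate-step (isConvex⇒convex convH) (proj₁ atomB) B⊆W)

      atomH : IsAtom G H
      atomH = fromAtom (nbhd⊆atom v v∈W min)

      sound′ : ∀ U → U ∈ 𝒰 ++ [ H ] → IsAtom G U
      sound′ U m with ∈-++⁻ 𝒰 m
      ... | inj₁ U∈𝒰 = sound inv U U∈𝒰
      ... | inj₂ (here refl) = atomH

      complete′ : ∀ B → IsAtom G B → B ∈ 𝒰 ++ [ H ] ⊎ B ⊆ remainder W H
      complete′ B atomB with complete inv B atomB
      ... | inj₁ B∈𝒰 = inj₁ (∈-++⁺ˡ B∈𝒰)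
      ... | inj₂ B⊆W with candidate-step (isConvex⇒convex convH) (proj₁ atomB) B⊆W
      ...   | inj₂ B⊆W′ = inj₂ B⊆W′
      ...   | inj₁ B⊆H = inj₁ (∈-++⁺ʳ 𝒰 (here (atom⊆atom⇒≡ atomB atomH B⊆H)))

theorem3p3 : ∀ {n : ℕ} (G : Graph n) → Connected G (V G) →
    (α : Fin n → Fin n) → IsMCSOrdering G α →
    (∃ λ 𝒰 → RDA G α (V G) [] 𝒰) ×
    (∀ 𝒰 → RDA G α (V G) [] 𝒰 → ∀ (A : Subset n) → (A ∈ 𝒰 ⇔ IsAtom G A))
theorem3p3 G _ α mcs =
  run G α (V G) [] ,
  λ 𝒰 r → invariant⇒atoms G α mcs (record { sound = λ _ () ; complete = λ _ _ → inj₂ ⊆⊤ }) r
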